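{- Let $m\geq 1$ and let $L=\{1^{a_1},2^{a_2},\ldots,m^{a_m}\}$ be an admissible list with $a_1\geq a_2\geq\cdots\geq a_m>0$, and let $v=|L|+1$. Then there exists a Hamiltonian path $H$ of $K_v$ with $\ell(H)=L$.
   Context: $K_v$ is the complete graph on vertex set $\{0,1,\ldots,v-1\}$. The length of an edge $[x,y]$ is $\min(|x-y|,\,v-|x-y|)$, and for a subgraph $H$, $\ell(H)$ is the list (multiset) of lengths of its edges. The notation $\{1^{a_1},\ldots,m^{a_m}\}$ denotes the multiset containing $a_i$ copies of $i$; $|L|=\sum a_i$. A list $L$ of $v-1$ positive integers not exceeding $\lfloor v/2\rfloor$ is called admissible if for every divisor $d$ of $v$, the number of elements of $L$ (with multiplicity) that are multiples of $d$ is at most $v-d$. -}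

module Defs where

open import Data.Nat using (ℕ; zero; suc; _+_; _∸_; _≤_; _<_; _⊓_; ∣_-_∣; _/_)
open import Data.Nat.Divisibility using (_∣_; _∣?_)
open import Data.List using (List; []; _∷_; length; map; filter; concat; replicate; applyUpTo; upTo; zipWith; drop)
open import Data.List.Relation.Unary.All using (All)
open import Data.List.Relation.Binary.Permutation.Propositional using (_↭_)
open import Relation.Binary.PropositionalEquality using (_≡_)
open import Data.Product using (_×_; ∃-syntax)

-- The list {1^{a 1}, 2^{a 2}, ..., m^{a m}}  (a is read only at 1..m)
listOf : (m : ℕ) → (ℕ → ℕ) → List ℕ
listOf m a = concat (applyUpTo (λ i → replicate (a (suc i)) (suc i)) m)

edgeLength : ℕ → ℕ → ℕ → ℕ
edgeLength v x y = ∣ x - y ∣ ⊓ (v ∸ ∣ x - y ∣)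

countMultiples : ℕ → List ℕ → ℕ
countMultiples d L = length (filter (λ x → d ∣? x) L)

Admissible : ℕ → List ℕ → Set
Admissible v L =
  (length L + 1 ≡ v) × All (λ x → 1 ≤ x × x ≤ v / 2) L
    × (∀ d → d ∣ v → countMultiples d L ≤ v ∸ d)

-- A Hamiltonian path of K_v, given as an ordering p of the vertices {0,...,v-1}
-- (p is a permutation of upTo v); its edges are [p_i, p_{i+1}].
IsHamPath : ℕ → List ℕ → Set
IsHamPath v p = p ↭ upTo v

pathLengths : ℕ → List ℕ → List ℕ
pathLengths v p = zipWith (edgeLength v) p (drop 1 p)

{-# OPTIONS --safe #-}

-- Write L as a union of blocks {1,...,n₁}, {1,...,n₂}, ... with n₁ ≤ n₂ ≤ ...; since all entries are at most v/2, it
-- suffices to realise L by the absolute differences of a path. Start with a single vertex and place on top of the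
-- interval covered so far, one block after the other, an interval of n new vertices. Because n is at least the
-- previous block size, the jump of length n from the current end lands inside the new interval, at a vertex we do not
-- control, and the remaining differences 1, ..., n-1 are supplied by a graceful labelling of the path on n vertices
-- whose first label is prescribed. Such labellings are glued from zigzags: for even n they can be taken bipartite
-- between low and high labels, and odd n reduces to that case.
module Submission where

open import Defs
open import Data.Nat using (ℕ; zero; suc; _+_; _*_; _∸_; _/_; _≤_; _<_; z≤n; s≤s; ∣_-_∣; compare; less; equal; greater)
open import Data.Nat.Properties
open import Data.Nat.DivMod using (m/n*n≤m)
open import Data.Nat.Tactic.RingSolver using (solve)
open import Data.List using (List; []; _∷_; _++_; length; map; concat; replicate; applyUpTo; zipWith)
open import Data.List.Properties using (map-++; applyUpTo-∷ʳ; concat-++; length-++; ++-identityʳ)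
open import Data.List.Relation.Unary.All as All using (All)
open import Data.List.Relation.Binary.Permutation.Propositional using (_↭_; prep; ↭-refl; ↭-sym; ↭-trans; ↭-reflexive)
open import Data.List.Relation.Binary.Permutation.Propositional.Properties using (All-resp-↭; map⁺; ++⁺; ++⁺ˡ; ++⁺ʳ; ↭-length; ++-commutativeMonoid)
open import Algebra.Solver.CommutativeMonoid (++-commutativeMonoid {A = ℕ}) using (_⊕_; _⊜_) renaming (solve to bag)
open import Data.Product using (_×_; _,_; proj₂; ∃-syntax)
open import Data.Sum using (_⊎_; inj₁; inj₂)
open import Relation.Nullary using (yes; no)
open import Relation.Binary.PropositionalEquality using (_≡_; refl; sym; trans; cong; cong₂; subst; module ≡-Reasoning)

-- Intervals as lists

range : ℕ → ℕ → List ℕ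
range s zero    = []
range s (suc k) = s ∷ range (suc s) k

-- The endpoints enter through equations, so callers can keep `t` and `n` in any shape and leave the
-- arithmetic to the solver.
range-split : ∀ {s j t k n} → s + j ≡ t → j + k ≡ n → range s n ≡ range s j ++ range t k
range-split {s} {zero}  {k = k} refl refl = cong (λ t → range t k) (sym (+-identityʳ s))
range-split {s} {suc j} {t} {k} eq   refl =
  cong (s ∷_) (range-split (trans (sym (+-suc s j)) eq) refl)

range-≡ : ∀ {s t k} → s ≡ t → range s k ≡ range t k
range-≡ refl = refl

range-last : ∀ {s t} k → s + k ≡ t → range s (suc k) ↭ t ∷ range s k
range-last {s} {t} k eq = ↭-trans
  (↭-reflexive (range-split eq (+-comm k 1)))
  (bag 2 (λ xs x → xs ⊕ x ⊜ x ⊕ xs) ↭-refl (range s k) (t ∷ []))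

map-+-range : ∀ c s k → map (c +_) (range s k) ≡ range (c + s) k
map-+-range c s zero    = refl
map-+-range c s (suc k) = cong (c + s ∷_) (trans (map-+-range c (suc s) k) (range-≡ (+-suc c s)))

map-∸-range : ∀ {M} s k → s + k ≡ suc M → map (M ∸_) (range s k) ↭ range 0 k
map-∸-range s zero    eq = ↭-refl
map-∸-range {M} s (suc k) eq = ↭-trans
  (↭-trans (↭-reflexive (cong (_∷ map (M ∸_) (range (suc s) k)) M∸s≡k))
           (prep k (map-∸-range (suc s) k (trans (sym (+-suc s k)) eq))))
  (↭-sym (range-last k refl))
  where
  M∸s≡k : M ∸ s ≡ k
  M∸s≡k = trans (cong (_∸ s) (suc-injective (trans (sym eq) (+-suc s k)))) (m+n∸m≡n s k)

range-< : ∀ s k → All (_< s + k) (range s k)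
range-< s zero    = All.[]
range-< s (suc k) = m<m+n s (s≤s z≤n) All.∷ subst (λ t → All (_< t) (range (suc s) k)) (sym (+-suc s k)) (range-< (suc s) k)

applyUpTo-range : ∀ s n {f} → (∀ i → f i ≡ s + i) → applyUpTo f n ≡ range s n
applyUpTo-range s zero    f≗ = refl
applyUpTo-range s (suc n) f≗ = cong₂ _∷_ (trans (f≗ 0) (+-identityʳ s))
  (applyUpTo-range (suc s) n (λ i → trans (f≗ (suc i)) (+-suc s i)))

length-range : ∀ s k → length (range s k) ≡ k
length-range s zero    = refl
length-range s (suc k) = cong suc (length-range (suc s) k)

-- Trails and their symmetries

-- Trail x z V D: a path from x to z visiting the bag of vertices V, with absolute differences the bag D.
data Trail : ℕ → ℕ → List ℕ → List ℕ → Set where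
  stop : ∀ x → Trail x x (x ∷ []) []
  up   : ∀ {y z V D} x d → Trail y z V D → x + d ≡ y → Trail x z (x ∷ V) (d ∷ D)
  down : ∀ {y z V D} x d → Trail y z V D → y + d ≡ x → Trail x z (x ∷ V) (d ∷ D)
  -- With this constructor the bags need not follow the visiting order and can be presented as
  -- intervals.
  perm : ∀ {x z V V′ D D′} → Trail x z V D → V ↭ V′ → D ↭ D′ → Trail x z V′ D′

-- This encodes that the start lies in the bag `V`, in a form that passes through `perm`.
source : ∀ {P : ℕ → Set} {x z V D} → Trail x z V D → All P V → P x
source (stop _)     (p All.∷ _) = p
source (up _ _ _ _)   (p All.∷ _) = p
source (down _ _ _ _) (p All.∷ _) = p
source (perm t v _) ps          = source t (All-resp-↭ (↭-sym v) ps)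

target : ∀ {P : ℕ → Set} {x z V D} → Trail x z V D → All P V → P z
target (stop _)     (p All.∷ _)  = p
target (up _ _ t _)   (_ All.∷ ps) = target t ps
target (down _ _ t _) (_ All.∷ ps) = target t ps
target (perm t v _) ps           = target t (All-resp-↭ (↭-sym v) ps)

join : ∀ {x y z w V D V′ D′} d → Trail x y V D → y + d ≡ z → Trail z w V′ D′ →
       Trail x w (V ++ V′) (D ++ d ∷ D′)
join d (stop _)       eq u = up _ d u eq
join d (up x e t eq′)   eq u = up x e (join d t eq u) eq′
join d (down x e t eq′) eq u = down x e (join d t eq u) eq′
join d (perm t v w)   eq u = perm (join d t eq u) (++⁺ʳ _ v) (++⁺ʳ _ w)

translate : ∀ c {x z V D} → Trail x z V D → Trail (c + x) (c + z) (map (c +_) V) D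
translate c (stop x)              = stop (c + x)
translate c (up x d t eq)       = up (c + x) d (translate c t) (trans (+-assoc c x d) (cong (c +_) eq))
translate c (down {y} x d t eq) = down (c + x) d (translate c t) (trans (+-assoc c y d) (cong (c +_) eq))
translate c (perm t v w)          = perm (translate c t) (map⁺ (c +_) v) w

reflect-step : ∀ {M x y} d → x + d ≡ y → y ≤ M → (M ∸ y) + d ≡ M ∸ x
reflect-step {M} {x} d refl x+d≤M = begin
  (M ∸ (x + d)) + d  ≡⟨ cong (_+ d) (∸-+-assoc M x d) ⟨
  (M ∸ x ∸ d) + d    ≡⟨ m∸n+n≡m (≤-trans (≤-reflexive (sym (m+n∸m≡n x d))) (∸-monoˡ-≤ x x+d≤M)) ⟩
  M ∸ x              ∎
  where open ≡-Reasoning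

-- The bound keeps truncated subtraction exact, so differences survive while `up` and `down` trade
-- places.
reflect : ∀ M {x z V D} → All (_≤ M) V → Trail x z V D → Trail (M ∸ x) (M ∸ z) (map (M ∸_) V) D
reflect M _           (stop x)      = stop (M ∸ x)
reflect M (_ All.∷ bs) (up x d t eq)   = down (M ∸ x) d (reflect M bs t) (reflect-step d eq (source t bs))
reflect M (b All.∷ bs) (down x d t eq) = up (M ∸ x) d (reflect M bs t) (reflect-step d eq b)
reflect M bs           (perm t v w)  = perm (reflect M (All-resp-↭ (↭-sym v) bs) t) (map⁺ (M ∸_) v) w

differences : ∀ {x z V D} → Trail x z V D →
              ∃[ p ] (x ∷ p ↭ V × zipWith ∣_-_∣ (x ∷ p) p ↭ D)
differences (stop x) = [] , ↭-refl , ↭-refl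
differences (up {y} x d t eq) with p , v , w ← differences t =
  y ∷ p , prep x v ,
  ↭-trans (↭-reflexive (cong (_∷ _) (trans (cong (∣ x -_∣) (sym eq)) (∣m-m+n∣≡n x d)))) (prep d w)
differences (down {y} x d t eq) with p , v , w ← differences t =
  y ∷ p , prep x v ,
  ↭-trans (↭-reflexive (cong (_∷ _) (trans (cong (∣_- y ∣) (sym eq)) (trans (∣-∣-comm (y + d) y) (∣m-m+n∣≡n y d))))) (prep d w)
differences (perm t v w) with p , v′ , w′ ← differences t = p , ↭-trans v′ v , ↭-trans w′ w

relabel-source : ∀ {x y z V D} → x ≡ y → Trail x z (x ∷ V) D → Trail y z (y ∷ V) D
relabel-source refl t = t

-- Zigzags

-- The zigzag i, i+d, i-1, i+d+1, ..., 1, 2i+d-1, 0, continued by a trail leaving 0.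
outward : ∀ i d {z V D} → Trail 0 z (0 ∷ V) D →
          Trail i z (range 0 (suc i) ++ range (i + d) i ++ V) (range d (i * 2) ++ D)
outward zero    d t = t
outward (suc i) d {V = V} t = perm
  (up (suc i) d (down (suc i + d) (suc d) (outward i (2 + d) t) (solve (i ∷ d ∷ []))) refl)
  (↭-trans
    (bag 5 (λ x y A B C → x ⊕ y ⊕ A ⊕ B ⊕ C ⊜ (x ⊕ A) ⊕ (y ⊕ B) ⊕ C) ↭-refl
      (suc i ∷ []) (suc i + d ∷ []) (range 0 (suc i)) (range (i + (2 + d)) i) V)
    (++⁺ (↭-sym (range-last (suc i) refl))
         (++⁺ʳ V (prep _ (↭-reflexive (range-≡ {i + (2 + d)} {2 + (i + d)} (solve (i ∷ d ∷ []))))))))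
  ↭-refl

-- The zigzag x, x+2j+g, x+1, x+2j+g-1, ..., x+j-1, x+j+1+g, x+j, continued by a trail leaving x+j.
inward : ∀ j x g {z V D} → Trail (x + j) z (x + j ∷ V) D →
         Trail x z (range x (suc j) ++ range (x + j + 1 + g) j ++ V) (range (suc g) (j * 2) ++ D)
inward zero x g t = relabel-source (+-identityʳ x) t
inward (suc j) x g {V = V} {D = D} t = let top = suc x + (suc (j * 2 + g)) in perm
  (up x (2 + (j * 2 + g))
    (down top (suc (j * 2 + g))
      (inward j (suc x) g (relabel-source (+-suc x j) t))
      refl)
    (solve (x ∷ j ∷ g ∷ [])))
  (↭-trans
    (bag 5 (λ a b A B C → a ⊕ b ⊕ A ⊕ B ⊕ C ⊜ (a ⊕ A) ⊕ (b ⊕ B) ⊕ C) ↭-refl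
      (x ∷ []) (top ∷ []) (range (suc x) (suc j)) (range (suc x + j + 1 + g) j) V)
    (++⁺ˡ (x ∷ range (suc x) (suc j)) (++⁺ʳ V
      (↭-trans (prep top (↭-reflexive (range-≡ {suc x + j + 1 + g} {x + suc j + 1 + g} (solve (x ∷ j ∷ g ∷ [])))))
               (↭-sym (range-last {x + suc j + 1 + g} {top} j (solve (x ∷ j ∷ g ∷ []))))))))
  (↭-trans
    (bag 4 (λ a b A B → a ⊕ b ⊕ A ⊕ B ⊜ (A ⊕ b ⊕ a) ⊕ B) ↭-refl
      (suc (suc (j * 2 + g)) ∷ []) (suc (j * 2 + g) ∷ []) (range (suc g) (j * 2)) D)
    (++⁺ʳ D (↭-reflexive (sym (range-split {suc g} {j * 2} {suc (j * 2 + g)} {2} (solve (j ∷ g ∷ [])) (+-comm (j * 2) 2))))))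

-- The zigzag p+i+g, p+i-1, p+i+g+1, p+i-2, ... starts at the edge of a gap of g labels and recedes
-- from it on both sides, so its differences grow from g+1.
expanding : ∀ i p g → ∃[ z ] Trail (p + i + g) z (range p i ++ range (p + i + g) (suc i)) (range (suc g) (i * 2))
expanding zero    p g = _ , stop _
expanding (suc i) p g with z , t ← expanding i p (2 + g) = let q = p + suc i + g in z , perm
  (down q (suc g) (up (p + i) (2 + g) t refl) (solve (p ∷ i ∷ g ∷ [])))
  (↭-trans
    (bag 4 (λ a b A B → a ⊕ b ⊕ A ⊕ B ⊜ (b ⊕ A) ⊕ (a ⊕ B)) ↭-refl
      (q ∷ []) (p + i ∷ []) (range p i) (range (p + i + (2 + g)) (suc i)))
    (++⁺ (↭-sym (range-last i refl))
         (prep q (↭-reflexive (range-≡ {p + i + (2 + g)} {suc (p + suc i + g)} {suc i} (solve (p ∷ i ∷ g ∷ [])))))))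
  ↭-refl

-- Bipartite labellings

-- A path alternating between suc r low and suc r high labels, with a gap of g labels between the two classes.
Bipartite : ℕ → ℕ → ℕ → Set
Bipartite g r x = ∃[ z ] Trail x z (range 0 (suc r) ++ range (suc r + g) (suc r)) (range (suc g) (suc (r * 2)))

-- The first labels 0..x and as many top ones are used by a zigzag ending at the top label, from which the jump over
-- the remaining labels lands on the x-th of them: a smaller instance with the same gap.
bipartite-outward : ∀ g r x → Bipartite g r x → Bipartite g (x + suc r) x
bipartite-outward g r x (z , t) =
  -- `e` is the first difference above the inner ones, kept for the jump down from the top label
  -- `M`; the zigzag takes `d` onwards.
  let e = r * 2 + 2 + g ; d = suc e ; M = d + x * 2
      A = range (suc x) (suc r) ; B = range (suc x + (suc r + g)) (suc r) ; s = suc (x + suc r)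
      inner : Trail (suc x + x) (suc x + z) (A ++ B) (range (suc g) (suc (r * 2)))
      inner = perm (translate (suc x) t)
        (↭-reflexive (trans (map-++ (suc x +_) (range 0 (suc r)) _)
          (cong₂ _++_ (trans (map-+-range (suc x) 0 (suc r)) (range-≡ {k = suc r} (+-identityʳ (suc x))))
                      (map-+-range (suc x) (suc r + g) (suc r)))))
        ↭-refl
  in suc x + z , perm
    (outward x d (up 0 M (down M e inner (solve (x ∷ r ∷ g ∷ []))) refl))
    (↭-trans
      (bag 5 (λ R S m A B → R ⊕ S ⊕ m ⊕ A ⊕ B ⊜ (R ⊕ A) ⊕ (B ⊕ m ⊕ S)) ↭-refl
        (range 0 (suc x)) (range (x + d) x) (M ∷ []) A B)
      (++⁺ (↭-reflexive (sym (range-split {0} {suc x} {suc x} {suc r} refl refl)))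
        (↭-trans (++⁺ˡ B (↭-sym (range-last {x + d} {M} x (solve (x ∷ r ∷ g ∷ [])))))
          (↭-reflexive (trans (cong (_++ range (x + d) (suc x)) (range-≡ {k = suc r} (sym (+-assoc (suc x) (suc r) g))))
            (sym (range-split {s + g} {suc r} {x + d} {suc x} {s} (solve (x ∷ r ∷ g ∷ [])) (solve (x ∷ r ∷ [])))))))))
    (↭-trans
      (bag 4 (λ R m e C → R ⊕ m ⊕ e ⊕ C ⊜ C ⊕ (e ⊕ m ⊕ R)) ↭-refl
        (range d (x * 2)) (M ∷ []) (e ∷ []) (range (suc g) (suc (r * 2))))
      (↭-trans (++⁺ˡ (range (suc g) (suc (r * 2))) (prep e (↭-sym (range-last {d} {M} (x * 2) refl))))
        (↭-reflexive (sym (range-split {suc g} {suc (r * 2)} {e} {suc (suc (x * 2))} (solve (r ∷ g ∷ [])) (solve (x ∷ r ∷ [])))))))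

-- The start is the middle low label. After the zigzag to 0, a jump to the lowest high label reaches
-- the edge of the gap, and an expanding zigzag uses up the rest.
bipartite-centre : ∀ g x → Bipartite g (x * 2) x
bipartite-centre g x with z , t ← expanding x (suc x) g =
  let q = suc x + x + g ; d = suc q ; s = suc (x * 2) in z , perm
    (outward x d (up 0 q t refl))
    (↭-trans
      (bag 4 (λ R S A B → R ⊕ S ⊕ A ⊕ B ⊜ (R ⊕ A) ⊕ (B ⊕ S)) ↭-refl
        (range 0 (suc x)) (range (x + d) x) (range (suc x) x) (range q (suc x)))
      (++⁺ (↭-reflexive (sym (range-split {0} {suc x} {suc x} {x} {s} refl (solve (x ∷ [])))))
        (↭-reflexive (trans (cong₂ _++_ (range-≡ {q} {s + g} {suc x} (solve (x ∷ g ∷ []))) refl)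
          (sym (range-split {s + g} {suc x} {x + d} {x} {s} (solve (x ∷ g ∷ [])) (solve (x ∷ []))))))))
    (↭-trans
      (bag 3 (λ R e C → R ⊕ e ⊕ C ⊜ C ⊕ (e ⊕ R)) ↭-refl
        (range d (x * 2)) (q ∷ []) (range (suc g) (x * 2)))
      (↭-reflexive (sym (range-split {suc g} {x * 2} {q} {suc (x * 2)} (solve (x ∷ g ∷ [])) (solve (x ∷ []))))))

-- The inner labels are used by a zigzag ending at the lowest high label; the labels left outside it form an instance
-- with a wider gap.
bipartite-inward : ∀ g j x → Bipartite (2 + j * 2 + g) (j + x) x → Bipartite g (suc (j + x) + j) (suc (j + x))
bipartite-inward g j x (z , t) =
  -- `g′` is both the first difference left free by the inner labels and the widened gap: j+1 low
  -- and j+1 high labels join the old one.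
  let y = suc (j + x) ; g′ = 2 + j * 2 + g ; s = suc (y + j) in z , perm
    (inward j y (suc g) (up (y + j) (suc g) (down (s + g) g′ t (solve (x ∷ j ∷ g ∷ []))) (+-suc (y + j) g)))
    (↭-trans
      (bag 5 (λ P Q h A B → P ⊕ Q ⊕ h ⊕ A ⊕ B ⊜ (A ⊕ P) ⊕ (h ⊕ Q ⊕ B)) ↭-refl
        (range y (suc j)) (range (y + j + 1 + suc g) j) (s + g ∷ []) (range 0 y) (range (y + g′) y))
      (++⁺ (↭-reflexive (sym (range-split {0} {y} {y} {suc j} {s} refl (+-suc y j))))
        (prep (s + g) (↭-reflexive (trans (cong₂ _++_ (range-≡ {y + j + 1 + suc g} {suc (s + g)} {j} (solve (x ∷ j ∷ g ∷ []))) refl)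
          (sym (range-split {suc (s + g)} {j} {y + g′} {y} {y + j} (solve (x ∷ j ∷ g ∷ [])) (+-comm j y))))))))
    (↭-trans
      (bag 4 (λ P a b C → P ⊕ a ⊕ b ⊕ C ⊜ a ⊕ (P ⊕ b ⊕ C)) ↭-refl
        (range (2 + g) (j * 2)) (suc g ∷ []) (g′ ∷ []) (range (suc g′) (suc ((j + x) * 2))))
      (prep (suc g) (↭-reflexive (sym (range-split {2 + g} {j * 2} {g′} {suc (suc ((j + x) * 2))} {(y + j) * 2} (solve (j ∷ g ∷ [])) (solve (x ∷ j ∷ [])))))))

-- The three cases are x < e, x = e, x > e, where x and e are the numbers of low labels below and above the start.
bipartite : ∀ n g x e → x + e < n → Bipartite g (x + e) x
-- The fuel `n` bounds the number of low labels, which drops by x+1 or by j+1 in the recursive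
-- calls.
bipartite (suc n) g x e (s≤s x+e≤n) with compare x e
... | less x k    = bipartite-outward g (x + k) x (bipartite n g x k (≤-trans (+-monoʳ-< x (s≤s (m≤n+m k x))) x+e≤n))
... | equal x     = subst (λ r → Bipartite g r x) (trans (*-comm x 2) (cong (x +_) (+-identityʳ x))) (bipartite-centre g x)
... | greater j k = bipartite-inward g j k
  (subst (λ r → Bipartite (2 + j * 2 + g) r k) (+-comm k j)
    (bipartite n (2 + j * 2 + g) k j (≤-trans (s≤s (≤-trans (≤-reflexive (+-comm k j)) (m≤m+n (j + k) j))) x+e≤n)))

-- Graceful labellings with prescribed first label

Graceful : ℕ → ℕ → Set
Graceful N x = ∃[ z ] Trail x z (range 0 (suc N)) (range 1 N)

graceful-reflect : ∀ N {x} → Graceful N x → Graceful N (N ∸ x)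
graceful-reflect N (z , t) = _ , perm (reflect N (All.map ≤-pred (range-< 0 (suc N))) t) (map-∸-range 0 (suc N) refl) ↭-refl

-- Reflection exchanges the starts x and N-x, one of which is at most h.
graceful-lower-half : ∀ N h → N ≤ suc (h * 2) → (∀ x → x ≤ h → Graceful N x) → ∀ x → x ≤ N → Graceful N x
graceful-lower-half N h N≤ lower x x≤N with x ≤? h
... | yes x≤h = lower x x≤h
... | no x≰h = subst (Graceful N) (m∸[m∸n]≡n x≤N) (graceful-reflect N (lower (N ∸ x) (m≤n+o⇒m∸n≤o N x (begin
  N            ≤⟨ N≤ ⟩
  suc (h * 2)  ≡⟨ solve (h ∷ []) ⟩
  suc h + h    ≤⟨ +-monoˡ-≤ h (≰⇒> x≰h) ⟩
  x + h        ∎))))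
  where open ≤-Reasoning

-- The parity is that of the number of vertices. With gap 0, low and high labels together fill an
-- interval.
graceful-even : ∀ r x → x ≤ suc (r * 2) → Graceful (suc (r * 2)) x
graceful-even r = graceful-lower-half (suc (r * 2)) r ≤-refl lower
  where
  lower : ∀ x → x ≤ r → Graceful (suc (r * 2)) x
  lower x x≤r with e , refl ← m≤n⇒∃[o]m+o≡n x≤r with z , t ← bipartite (suc (x + e)) 0 x e ≤-refl = z , perm t
    (↭-reflexive (sym (range-split {0} {suc (x + e)} {suc (x + e) + 0} {suc (x + e)} {suc (suc ((x + e) * 2))} (sym (+-identityʳ _)) (solve (x ∷ e ∷ [])))))
    ↭-refl

-- The zigzag from x to 0 leaves an interval of `k` labels just above x, an even number; the jump of
-- length `k` from 0 hits its label number `w`.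
graceful-outward : ∀ b x w → x + w ≡ suc (b * 2) → Graceful (suc (b * 2)) w → Graceful ((x + suc b) * 2) x
graceful-outward b x w eq (z , t) =
  let k = suc (suc (b * 2)) ; C = range (suc x) k
      inner : Trail (suc x + w) (suc x + z) C (range 1 (suc (b * 2)))
      inner = perm (translate (suc x) t)
        (↭-reflexive (trans (map-+-range (suc x) 0 k) (range-≡ {k = k} (+-identityʳ (suc x)))))
        ↭-refl
  in suc x + z , perm
    (outward x (suc k) (up 0 k inner (sym (cong suc eq))))
    (↭-trans
      (bag 3 (λ P Q C → P ⊕ Q ⊕ C ⊜ P ⊕ C ⊕ Q) ↭-refl (range 0 (suc x)) (range (x + suc k) x) C)
      (↭-reflexive (sym (trans
        (range-split {0} {suc x} {suc x} {k + x} {suc ((x + suc b) * 2)} refl (solve (x ∷ b ∷ [])))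
        (cong (range 0 (suc x) ++_) (range-split {suc x} {k} {x + suc k} {x} (solve (x ∷ b ∷ [])) refl))))))
    (↭-trans
      (bag 3 (λ P a C → P ⊕ a ⊕ C ⊜ C ⊕ a ⊕ P) ↭-refl (range (suc k) (x * 2)) (k ∷ []) (range 1 (suc (b * 2))))
      (↭-reflexive (sym (range-split {1} {suc (b * 2)} {k} {suc (x * 2)} {(x + suc b) * 2} refl (solve (x ∷ b ∷ []))))))

-- The zigzag fills the central 2u+1 labels with differences 1, ..., 2u; the jump down by 2u+1
-- reaches label k of a bipartite path whose gap is that centre.
graceful-inward : ∀ u k → Bipartite (suc (u * 2)) (u + k) k → Graceful ((suc (u + k) + u) * 2) (suc (u + k))
graceful-inward u k (z , t) =
  let y = suc (u + k) ; g = suc (u * 2) in z , perm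
    (inward u y 0 (down (y + u) g t (solve (u ∷ k ∷ []))))
    (↭-trans
      (bag 4 (λ P Q A B → P ⊕ Q ⊕ A ⊕ B ⊜ A ⊕ P ⊕ Q ⊕ B) ↭-refl
        (range y (suc u)) (range (y + u + 1 + 0) u) (range 0 y) (range (y + g) y))
      (↭-reflexive (sym (trans
        (range-split {0} {y} {y} {suc u + (u + y)} {suc ((y + u) * 2)} refl (solve (u ∷ k ∷ [])))
        (cong (range 0 y ++_) (trans
          (range-split {y} {suc u} {y + u + 1 + 0} {u + y} (solve (u ∷ k ∷ [])) refl)
          (cong (range y (suc u) ++_) (range-split {y + u + 1 + 0} {u} {y + g} {y} (solve (u ∷ k ∷ [])) refl))))))))
    (↭-reflexive (sym (range-split {1} {u * 2} {g} {suc (suc ((u + k) * 2))} {(y + u) * 2} refl (solve (u ∷ k ∷ [])))))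

graceful-odd : ∀ a x → x ≤ a * 2 → Graceful (a * 2) x
graceful-odd a = graceful-lower-half (a * 2) a (n≤1+n _) lower
  where
  outer : ∀ b x → x ≤ suc b → Graceful ((x + suc b) * 2) x
  outer b x x≤1+b = graceful-outward b x (suc (b * 2) ∸ x) (m+[n∸m]≡n (≤-trans x≤1+b (s≤s (m≤m*n b 2))))
    (graceful-even b _ (m∸n≤m _ x))
  lower : ∀ x → x ≤ a → Graceful (a * 2) x
  -- `e` is the distance from the start to the middle label. Apart from the single vertex, x ≤ e is
  -- served by an outward zigzag and x > e by an inward one.
  lower x x≤a with e , refl ← m≤n⇒∃[o]m+o≡n x≤a with compare x e
  ... | less x k      = outer (x + k) x (m≤n⇒m≤1+n (m≤m+n x k))
  ... | equal zero    = 0 , stop 0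
  ... | equal (suc b) = outer b (suc b) ≤-refl
  ... | greater u k   = graceful-inward u k (subst (λ r → Bipartite (suc (u * 2)) r k) (+-comm k u)
                          (bipartite (suc (k + u)) (suc (u * 2)) k u ≤-refl))

halve : ∀ n → ∃[ h ] (n ≡ h * 2 ⊎ n ≡ suc (h * 2))
halve zero = 0 , inj₁ refl
halve (suc n) with halve n
... | h , inj₁ refl = h , inj₂ refl
... | h , inj₂ refl = suc h , inj₁ refl

graceful : ∀ N x → x ≤ N → Graceful N x
graceful N x x≤N with halve N
... | h , inj₁ refl = graceful-odd h x x≤N
... | h , inj₂ refl = graceful-even h x x≤N

-- Stacking blocks

-- The bound says that a jump of length n from the end of the trail leaves the interval covered so far.
Stack : ℕ → List ℕ → Set
Stack n D = ∃[ x ] ∃[ y ] (Trail x y (range 0 (suc (length D))) D × length D < y + n)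

stack-resp-↭ : ∀ {n D D′} → D ↭ D′ → Stack n D → Stack n D′
stack-resp-↭ {n} p (x , y , t , y≥) = x , y ,
  perm t (↭-reflexive (cong (λ l → range 0 (suc l)) (↭-length p))) p ,
  subst (_< y + n) (↭-length p) y≥

stack-weaken : ∀ {n D} → Stack n D → Stack (suc n) D
stack-weaken {n} (x , y , t , y≥) = x , y , t , ≤-trans y≥ (+-monoʳ-≤ y (n≤1+n n))

-- A jump of length N+1 from an old vertex cannot pass the N+1 new ones; `w` is its position among
-- them.
landing : ∀ {l w y N} → suc l + w ≡ y + suc N → y < suc l → w ≤ N
landing {l} {w} {y} {N} eq y<1+l = +-cancelˡ-≤ (suc l) w N (begin
  suc l + w  ≡⟨ eq ⟩
  y + suc N  ≡⟨ +-suc y N ⟩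
  suc y + N  ≤⟨ +-monoˡ-≤ N y<1+l ⟩
  suc l + N  ∎)
  where open ≤-Reasoning

stack-block : ∀ N D → Stack (suc N) D → Stack (suc N) (range 1 (suc N) ++ D)
stack-block N D (x , y , t , y≥) with w , eq ← m≤n⇒∃[o]m+o≡n y≥
  with z , u ← graceful N w (landing eq (target t (range-< 0 (suc (length D)))))
  = x , suc L + z ,
  perm (join (suc N) t (sym eq) (translate (suc L) u))
    (↭-reflexive (trans
      (cong (range 0 (suc L) ++_) (trans (map-+-range (suc L) 0 (suc N)) (range-≡ {k = suc N} (+-identityʳ (suc L)))))
      (sym (range-split {0} {suc L} {suc L} {suc N} refl (trans (+-comm (suc L) (suc N)) (trans (+-suc (suc N) L) (cong suc (sym len))))))))
    (↭-trans (bag 3 (λ D n R → D ⊕ n ⊕ R ⊜ (n ⊕ R) ⊕ D) ↭-refl D (suc N ∷ []) (range 1 N))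
      (++⁺ʳ D (↭-sym (range-last N refl)))) ,
  -- The new end lies above `L`, so another jump of length N+1 again leaves the covered interval.
  subst (_< suc L + z + suc N) (sym len) (s≤s (≤-trans (≤-reflexive (+-comm (suc N) L)) (+-monoˡ-≤ (suc N) (m≤m+n L z))))
  where
  L = length D
  len : length (range 1 (suc N) ++ D) ≡ suc N + L
  len = trans (length-++ (range 1 (suc N))) (cong (_+ L) (length-range 1 (suc N)))

-- Decomposing the list into blocks

listOf-suc : ∀ m a → listOf (suc m) a ≡ listOf m a ++ replicate (a (suc m)) (suc m)
listOf-suc m a = trans (cong concat (sym (applyUpTo-∷ʳ f m)))
  (trans (sym (concat-++ (applyUpTo f m) (f m ∷ []))) (cong (listOf m a ++_) (++-identityʳ (f m))))
  where
  f : ℕ → List ℕ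
  f i = replicate (a (suc i)) (suc i)

listOf-cong : ∀ m {a c} → (∀ i → 1 ≤ i → i ≤ m → a i ≡ c i) → listOf m a ≡ listOf m c
listOf-cong zero eq = refl
listOf-cong (suc m) {a} {c} eq = trans (listOf-suc m a) (trans
  (cong₂ (λ L k → L ++ replicate k (suc m)) (listOf-cong m (λ i 1≤i i≤m → eq i 1≤i (m≤n⇒m≤1+n i≤m))) (eq (suc m) (s≤s z≤n) ≤-refl))
  (sym (listOf-suc m c)))

listOf-increment : ∀ m a → range 1 m ++ listOf m a ↭ listOf m (λ i → suc (a i))
listOf-increment zero    a = ↭-refl
listOf-increment (suc m) a = ↭-trans
  (++⁺ (range-last m refl) (↭-reflexive (listOf-suc m a)))
  (↭-trans
    (bag 4 (λ n R L M → (n ⊕ R) ⊕ (L ⊕ M) ⊜ (R ⊕ L) ⊕ (n ⊕ M)) ↭-refl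
      (suc m ∷ []) (range 1 m) (listOf m a) (replicate (a (suc m)) (suc m)))
    (↭-trans (++⁺ʳ _ (listOf-increment m a)) (↭-reflexive (sym (listOf-suc m (λ i → suc (a i)))))))

stack-increment : ∀ m a b → Stack (suc m) (listOf (suc m) a) → Stack (suc m) (listOf (suc m) (λ i → b + a i))
stack-increment m a zero    st = st
stack-increment m a (suc b) st = stack-resp-↭ (listOf-increment (suc m) (λ i → b + a i))
  (stack-block m _ (stack-increment m a b st))

antitone : ∀ {m} {a : ℕ → ℕ} → (∀ i → 1 ≤ i → i < m → a (suc i) ≤ a i) → ∀ i → 1 ≤ i → i ≤ m → a m ≤ a i
antitone {zero}  dec (suc i) _ ()
antitone {suc m} dec i 1≤i i≤1+m with m≤n⇒m<n∨m≡n i≤1+m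
... | inj₂ refl      = ≤-refl
... | inj₁ (s≤s i≤m) = ≤-trans (dec m (≤-trans 1≤i i≤m) ≤-refl)
  (antitone (λ j 1≤j j<m → dec j 1≤j (m≤n⇒m≤1+n j<m)) i 1≤i i≤m)

-- Subtracting the smallest multiplicity `b` everywhere removes the largest entry. The induction
-- realises what is left, from smaller blocks, and `b` full blocks go on top.
stack-listOf : ∀ m a → (∀ i → 1 ≤ i → i < m → a (suc i) ≤ a i) → Stack (suc m) (listOf m a)
stack-listOf zero    a dec = 0 , 0 , stop 0 , s≤s z≤n
stack-listOf (suc m) a dec = stack-weaken (subst (Stack (suc m)) restore (stack-increment m c b
  (subst (Stack (suc m)) truncate (stack-listOf m c (λ i 1≤i i<m → ∸-monoˡ-≤ b (dec i 1≤i (m≤n⇒m≤1+n i<m)))))))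
  where
  b : ℕ
  b = a (suc m)
  c : ℕ → ℕ
  c i = a i ∸ b
  truncate : listOf m c ≡ listOf (suc m) c
  truncate = sym (trans (listOf-suc m c)
    (trans (cong (λ k → listOf m c ++ replicate k (suc m)) (n∸n≡0 b)) (++-identityʳ _)))
  restore : listOf (suc m) (λ i → b + c i) ≡ listOf (suc m) a
  restore = listOf-cong (suc m) (λ i 1≤i i≤1+m → m+[n∸m]≡n (antitone dec i 1≤i i≤1+m))

-- From differences to edge lengths

edgeLength≡difference : ∀ {v} x y → ∣ x - y ∣ ≤ v / 2 → edgeLength v x y ≡ ∣ x - y ∣
edgeLength≡difference {v} x y d≤v/2 = m≤n⇒m⊓n≡m (m+n≤o⇒m≤o∸n _ (begin
  d + d          ≤⟨ +-mono-≤ d≤v/2 d≤v/2 ⟩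
  v / 2 + v / 2  ≡⟨ trans (cong (v / 2 +_) (sym (+-identityʳ _))) (*-comm 2 (v / 2)) ⟩
  v / 2 * 2      ≤⟨ m/n*n≤m v 2 ⟩
  v              ∎))
  where
  open ≤-Reasoning
  d = ∣ x - y ∣

edgeLengths≡differences : ∀ {v} p q → All (_≤ v / 2) (zipWith ∣_-_∣ p q) → zipWith (edgeLength v) p q ≡ zipWith ∣_-_∣ p q
edgeLengths≡differences []      q       _ = refl
edgeLengths≡differences (x ∷ p) []      _ = refl
edgeLengths≡differences (x ∷ p) (y ∷ q) (d≤ All.∷ ds≤) =
  cong₂ _∷_ (edgeLength≡difference x y d≤) (edgeLengths≡differences p q ds≤)

theorem1p9 : (m : ℕ) → (a : ℕ → ℕ) → 1 ≤ m
    → (∀ i → 1 ≤ i → i < m → a (suc i) ≤ a i)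
    → (∀ i → 1 ≤ i → i ≤ m → 1 ≤ a i)
    → Admissible (length (listOf m a) + 1) (listOf m a)
    → ∃[ p ] (IsHamPath (length (listOf m a) + 1) p
    × pathLengths (length (listOf m a) + 1) p ↭ listOf m a)
theorem1p9 m a _ dec _ (_ , bounds , _)
  with x , _ , t , _ ← stack-listOf m a dec
  with p , visits , diffs ← differences t =
  x ∷ p ,
  ↭-trans visits (↭-reflexive (trans (cong (range 0) (+-comm 1 _)) (sym (applyUpTo-range 0 _ (λ _ → refl))))) ,
  -- The differences are the entries of the list in another order, hence inherit the bound v/2.
  ↭-trans (↭-reflexive (edgeLengths≡differences (x ∷ p) p (All-resp-↭ (↭-sym diffs) (All.map proj₂ bounds)))) diffs
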